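{- Suppose that $\mathbf h\in\mathbb Z^3\setminus\{\mathbf 0\}$ and $\varepsilon>0$. Then $S_3(P;\mathbf h)\ll P^{2+\varepsilon}$ for positive integers $P$, where the implied constant depends only on $\varepsilon$.
   Context: For a positive integer $P$ and $\mathbf h=(h_1,h_2,h_3)\in\mathbb Z^3$, $S_3(P;\mathbf h)$ denotes the number of integer tuples $(x_1,x_2,x_3,y_1,y_2,y_3)$ with $1\le x_i,y_i\le P$ $(1\le i\le 3)$ satisfying $$\sum_{i=1}^3(x_i^j-y_i^j)=h_j\quad (j=1,2,3).$$ -}

module Defs where

open import Data.Fin using (Fin; toℕ)
open import Data.Fin.Properties using (all?)
open import Data.Integer using (ℤ; -[1+_]; 0ℤ)
import Data.Integer as ℤ
import Data.Integer.Properties as ℤ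
open import Data.List using (List; []; _∷_; map; upTo; cartesianProduct; cartesianProductWith; filter; length)
open import Data.Nat as ℕ using (ℕ; zero; suc)
open import Data.Product using (_×_; _,_; ∃; ∃-syntax)
open import Data.Rational using (ℚ; 0ℚ; _+_; _-_; -_; _<_; ↥_; ↧ₙ_)
open import Data.Rational.Properties
open import Data.Sum using (_⊎_)
open import Data.Vec using (Vec; []; _∷_; lookup; zipWith; foldr′)
open import Relation.Binary.PropositionalEquality
open import Relation.Nullary using (¬_)
open import Relation.Unary using (Decidable)

-- Dedekind reals.
record ℝ : Set₁ where
  field
    lower upper     : ℚ → Set
    lower-inhabited : ∃ lower
    upper-inhabited : ∃ upper
    lower-closed    : ∀ {p q} → p < q → lower q → lower p
    upper-closed    : ∀ {p q} → p < q → upper p → upper q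
    lower-open      : ∀ {p} → lower p → ∃[ q ] p < q × lower q
    upper-open      : ∀ {q} → upper q → ∃[ p ] p < q × upper p
    disjoint        : ∀ {p} → ¬ (lower p × upper p)
    located         : ∀ {p q} → p < q → lower p ⊎ upper q

open ℝ public

Positive : ℝ → Set
Positive x = lower x 0ℚ

private
  +-cancel : ∀ p a → (p + a) - a ≡ p
  +-cancel p a = trans (+-assoc p a (- a))
    (trans (cong (p +_) (+-inverseʳ a)) (+-identityʳ p))

  -+-cancel : ∀ p a → (p - a) + a ≡ p
  -+-cancel p a = trans (+-assoc p (- a) a)
    (trans (cong (p +_) (+-inverseˡ a)) (+-identityʳ p))

infixr 6 _⊕_

-- The sum of a rational and a real.
_⊕_ : ℚ → ℝ → ℝ
a ⊕ x = record
  { lower = λ p → lower x (p - a)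
  ; upper = λ p → upper x (p - a)
  ; lower-inhabited = let p , l = lower-inhabited x in
      p + a , subst (lower x) (sym (+-cancel p a)) l
  ; upper-inhabited = let p , u = upper-inhabited x in
      p + a , subst (upper x) (sym (+-cancel p a)) u
  ; lower-closed = λ p<q → lower-closed x (+-monoˡ-< (- a) p<q)
  ; upper-closed = λ p<q → upper-closed x (+-monoˡ-< (- a) p<q)
  ; lower-open = λ {p} l → let q , p-a<q , l′ = lower-open x l in
      q + a
      , subst (_< q + a) (-+-cancel p a) (+-monoˡ-< a p-a<q)
      , subst (lower x) (sym (+-cancel q a)) l′
  ; upper-open = λ {q} u → let p , p<q-a , u′ = upper-open x u in
      p + a
      , subst (p + a <_) (-+-cancel q a) (+-monoˡ-< a p<q-a)
      , subst (upper x) (sym (+-cancel p a)) u′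
  ; disjoint = disjoint x
  ; located = λ p<q → located x (+-monoˡ-< (- a) p<q)
  }

-- PowerBoundℚ n C P r means n ≤ C · P^r: with r = a / d, both sides are raised
-- to the d-th power, and P^a is moved to the left when a is negative.
PowerBoundℚ : (n C P : ℕ) → ℚ → Set
PowerBoundℚ n C P r with ↥ r
... | ℤ.+ a    = n ℕ.^ (↧ₙ r) ℕ.≤ C ℕ.^ (↧ₙ r) ℕ.* P ℕ.^ a
... | -[1+ a ] = n ℕ.^ (↧ₙ r) ℕ.* P ℕ.^ suc a ℕ.≤ C ℕ.^ (↧ₙ r)

-- PowerBound n C P x means n ≤ C · P^x for P ≥ 1, where P^x is the infimum
-- of the P^r over rationals r > x.
PowerBound : (n C P : ℕ) → ℝ → Set
PowerBound n C P x = ∀ r → upper x r → PowerBoundℚ n C P r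

-- All n-tuples of integers with entries in [1, P], each listed once.
box : ℕ → (n : ℕ) → List (Vec ℤ n)
box P zero    = [] ∷ []
box P (suc n) = cartesianProductWith _∷_ (map (λ i → ℤ.+ suc i) (upTo P)) (box P n)

Σℤ : ∀ {n} → Vec ℤ n → ℤ
Σℤ = foldr′ ℤ._+_ 0ℤ

powerDifference : ∀ {n} → ℕ → Vec ℤ n → Vec ℤ n → ℤ
powerDifference j x y = Σℤ (zipWith (λ a b → a ℤ.^ j ℤ.- b ℤ.^ j) x y)

-- The entry of h at index j : Fin 3 belongs to the exponent j + 1.
Solution : Vec ℤ 3 → Vec ℤ 3 × Vec ℤ 3 → Set
Solution h (x , y) = ∀ (j : Fin 3) → powerDifference (suc (toℕ j)) x y ≡ lookup h j

solution? : ∀ h → Decidable (Solution h)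
solution? h (x , y) = all? λ j → powerDifference (suc (toℕ j)) x y ℤ.≟ lookup h j

S₃ : ℕ → Vec ℤ 3 → ℕ
S₃ P h = length (filter (solution? h) (cartesianProduct (box P 3) (box P 3)))

{-# OPTIONS --safe #-}

-- For a solution of the system in two pairs of variables with right-hand side
-- (h₁, h₂, h₃),
--   h₁⁴ - 4 h₁ h₃ + 3 h₂² = 12 (x₁ - y₁) (x₂ - y₁) (x₁ - y₂) (x₂ - y₂).
-- If no xᵢ equals a yₖ, this is nonzero, so the divisor bound leaves P^ε choices
-- for x₁ - y₁ and x₂ - y₁; these differences determine the solution when h₁ ≠ 0,
-- and otherwise determine it up to the choice of y₁.
-- In the system with three pairs, solutions with xᵢ = yₖ reduce to two pairs with
-- the same h ≠ 0, which have P^(1+ε) solutions. In the remaining ones, fix x₁ and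
-- y₁ and move them to the right-hand side: the new h₁ vanishes for at most one y₁
-- per x₁, which costs P^(1+ε), and each other choice costs only P^ε.
module Submission where

open import Defs
open import Algebra.Properties.AbelianGroup using (∙-cancelʳ)
open import Data.Fin as Fin using (Fin; toℕ; punchIn; combine)
open import Data.Fin.Patterns using (0F; 1F; 2F)
import Data.Fin.Properties as Fin
open import Data.Integer as ℤ using (ℤ; +_; +[1+_]; -[1+_]; 0ℤ; 1ℤ)
import Data.Integer.Properties as ℤ
import Data.Integer.Tactic.RingSolver as ℤSolver
open import Data.List as List using (List; []; _∷_)
open import Data.List.Membership.Propositional using (_∈_)
open import Data.List.Membership.Propositional.Properties
  using (∈-lookup; ∈-filter⁻; ∈-cartesianProduct⁻; ∈-cartesianProductWith⁻; ∈-map⁻; ∈-upTo⁻)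
open import Data.List.Relation.Unary.All as All using (All; []; _∷_)
open import Data.List.Relation.Unary.AllPairs using ([]; _∷_)
open import Data.List.Relation.Unary.Unique.Propositional using (Unique)
open import Data.List.Relation.Unary.Unique.Propositional.Properties
  using (map⁺; upTo⁺; filter⁺; cartesianProduct⁺; cartesianProductWith⁺)
open import Data.Nat as ℕ hiding (_/_)
open import Data.Nat.Coprimality using (Coprime; coprime-divisor)
open import Data.Nat.Divisibility
open import Data.Nat.DivMod using (m≡m%n+[m/n]*n; m%n<n; m/n*n≤m)
open import Data.Nat.Induction using (<-rec)
open import Data.Nat.ListAction using (product)
open import Data.Nat.Primality
open import Data.Nat.Primality.Factorisation using (factorise; module PrimeFactorisation)
open import Data.Nat.Properties
import Data.Nat.Tactic.RingSolver as ℕSolver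
open import Data.Product using (Σ-syntax; ∃-syntax; ∃₂; _×_; _,_; proj₁; proj₂)
open import Data.Rational as ℚ using (mkℚ; ↥_; ↧ₙ_; _/_)
import Data.Rational.Properties as ℚ
import Data.Rational.Unnormalised as ℚᵘ
import Data.Rational.Unnormalised.Properties as ℚᵘ
open import Data.Sum as Sum using (_⊎_; inj₁; inj₂)
open import Data.Unit using (⊤; tt)
open import Data.Vec using (Vec; []; _∷_; lookup; insertAt; removeAt; replicate)
open import Data.Vec.Properties using (insertAt-removeAt; ∷-injective)
open import Function using (_∘_)
open import Relation.Binary.Definitions using (tri<; tri≈; tri>)
open import Relation.Binary.PropositionalEquality
open import Relation.Nullary using (¬_; yes; no; contradiction)

-- Upper bounds for cardinalities by injective codes.

-- The code may depend on the proof of `S a`. This is harmless for an upper bound, and it lets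
-- witnesses found in the proof serve as codes.
record AtMost {A : Set} (n : ℕ) (S : A → Set) : Set where
  constructor encode
  field
    code      : ∀ {a} → S a → Fin n
    injective : ∀ {a b} (s : S a) (t : S b) → code s ≡ code t → a ≡ b

open AtMost

module _ {A : Set} {S : A → Set} where

  atMost-⊆ : ∀ {n} {T : A → Set} → (∀ {a} → S a → T a) → AtMost n T → AtMost n S
  atMost-⊆ S⊆T c = encode (λ s → code c (S⊆T s)) (λ s t → injective c (S⊆T s) (S⊆T t))

  atMost-≤ : ∀ {m n} → m ≤ n → AtMost m S → AtMost n S
  atMost-≤ m≤n c = encode (λ s → Fin.inject≤ (code c s) m≤n)
    (λ s t eq → injective c s t (Fin.inject≤-injective m≤n m≤n _ _ eq))

  atMost-1 : (∀ {a b} → S a → S b → a ≡ b) → AtMost 1 S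
  atMost-1 unique = encode (λ _ → Fin.zero) (λ s t _ → unique s t)

  atMost-∅ : ∀ {n} → (∀ {a} → ¬ S a) → AtMost n S
  atMost-∅ empty = encode (λ s → contradiction s empty) (λ s → contradiction s empty)

  atMost-image : ∀ {n} {B : Set} {T : B → Set} (f : B → A) →
                 (∀ {a} → S a → ∃[ b ] T b × a ≡ f b) → AtMost n T → AtMost n S
  atMost-image f S⊆fT c = encode (λ s → code c (proj₁ (proj₂ (S⊆fT s)))) inj
    where
    inj : ∀ {a b} (s : S a) (t : S b) →
          code c (proj₁ (proj₂ (S⊆fT s))) ≡ code c (proj₁ (proj₂ (S⊆fT t))) → a ≡ b
    inj s t eq with S⊆fT s | S⊆fT t
    ... | b , Tb , refl | b′ , Tb′ , refl = cong f (injective c Tb Tb′ eq)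

  atMost-⊎ : ∀ {m n} {T U : A → Set} → (∀ {a} → S a → T a ⊎ U a) →
             AtMost m T → AtMost n U → AtMost (m + n) S
  atMost-⊎ {m} {n} {T} {U} S⊆T∪U c d =
    encode (λ s → code⊎ (S⊆T∪U s)) (λ s t → inj (S⊆T∪U s) (S⊆T∪U t))
    where
    code⊎ : ∀ {a} → T a ⊎ U a → Fin (m + n)
    code⊎ x = Fin.join m n (Sum.map (code c) (code d) x)
    join-injective : ∀ {a b} (x : T a ⊎ U a) (y : T b ⊎ U b) → code⊎ x ≡ code⊎ y →
                     Sum.map (code c) (code d) x ≡ Sum.map (code c) (code d) y
    join-injective x y eq = trans (sym (Fin.splitAt-join m n _))
      (trans (cong (Fin.splitAt m) eq) (Fin.splitAt-join m n _))
    inj : ∀ {a b} (x : T a ⊎ U a) (y : T b ⊎ U b) → code⊎ x ≡ code⊎ y → a ≡ b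
    inj (inj₁ t) (inj₁ t′) eq = injective c t t′ (Fin.↑ˡ-injective n _ _ eq)
    inj (inj₂ u) (inj₂ u′) eq = injective d u u′ (Fin.↑ʳ-injective m _ _ eq)
    inj x@(inj₁ _) y@(inj₂ _) eq with () ← join-injective x y eq
    inj x@(inj₂ _) y@(inj₁ _) eq with () ← join-injective x y eq

  -- The basic counting step: choose `b` in `m` ways, then `a` in the fibre over `b` in `n` ways.
  -- Fibres are given by a relation, so `b` can be any witness extracted from `S a`.
  atMost-fibres : ∀ {m n} {B : Set} {U : B → Set} {R : B → A → Set} →
                  (∀ {a} → S a → ∃[ b ] U b × R b a) →
                  AtMost m U → (∀ b → AtMost n (R b)) → AtMost (m * n) S
  atMost-fibres {B = B} {U} {R} S⊆ c d =
    encode (λ s → code× (S⊆ s)) (λ s t → inj (S⊆ s) (S⊆ t))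
    where
    code× : ∀ {a} → ∃[ b ] U b × R b a → Fin _
    code× (b , u , r) = combine (code c u) (code (d b) r)
    inj : ∀ {a a′} (x : ∃[ b ] U b × R b a) (y : ∃[ b ] U b × R b a′) →
          code× x ≡ code× y → a ≡ a′
    inj (b , u , r) (b′ , u′ , r′) eq
      with Fin.combine-injective _ _ _ _ eq
    ... | eq₁ , eq₂ with injective c u u′ eq₁
    ...   | refl = injective (d b) r r′ eq₂

atMost-Fin : ∀ {n} → AtMost n (λ (_ : Fin n) → ⊤)
atMost-Fin = encode (λ {i} _ → i) (λ _ _ eq → eq)

lookup-injective : ∀ {A : Set} {xs : List A} → Unique xs →
                   ∀ i j → List.lookup xs i ≡ List.lookup xs j → i ≡ j
lookup-injective (_ ∷ _)   Fin.zero    Fin.zero    _  = refl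
lookup-injective (x∉ ∷ _)  Fin.zero    (Fin.suc j) eq = contradiction eq (All.lookup x∉ (∈-lookup j))
lookup-injective (x∉ ∷ _)  (Fin.suc i) Fin.zero    eq = contradiction (sym eq) (All.lookup x∉ (∈-lookup i))
lookup-injective (_ ∷ xs!) (Fin.suc i) (Fin.suc j) eq = cong Fin.suc (lookup-injective xs! i j eq)

-- Without repetitions in `xs`, sending an index to the code of its entry is injective, so the
-- pigeonhole principle applies.
length≤ : ∀ {A : Set} {n} {xs : List A} → Unique xs → AtMost n (_∈ xs) → List.length xs ≤ n
length≤ {xs = xs} xs! c = Fin.injective⇒≤ {f = λ i → code c (∈-lookup {xs = xs} i)}
  (λ eq → lookup-injective xs! _ _ (injective c (∈-lookup _) (∈-lookup _) eq))

-- Inequalities for powers of natural numbers.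

^-distribʳ-* : ∀ m n o → (m * n) ^ o ≡ m ^ o * n ^ o
^-distribʳ-* m n zero    = refl
^-distribʳ-* m n (suc o) = trans (cong ((m * n) *_) (^-distribʳ-* m n o))
  ([m*n]*[o*p]≡[m*o]*[n*p] m n (m ^ o) (n ^ o))

^-cancelˡ-≤ : ∀ o .{{_ : NonZero o}} {m n} → m ^ o ≤ n ^ o → m ≤ n
^-cancelˡ-≤ o m^o≤n^o = ≮⇒≥ λ n<m → ≤⇒≯ m^o≤n^o (^-monoˡ-< o n<m)

m≤m^n : ∀ m n .{{_ : NonZero n}} → m ≤ m ^ n
m≤m^n zero    (suc n) = z≤n
m≤m^n (suc m) (suc n) = m≤m*n (suc m) (suc m ^ n) {{m^n≢0 (suc m) n}}

1+n≤2^n : ∀ n → suc n ≤ 2 ^ n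
1+n≤2^n zero    = ≤-refl
1+n≤2^n (suc n) = begin
  suc (suc n)     ≤⟨ s≤s (m≤n+m (suc n) n) ⟩
  suc n + suc n   ≤⟨ +-mono-≤ (1+n≤2^n n) (1+n≤2^n n) ⟩
  2 ^ n + 2 ^ n   ≡⟨ cong (λ z → 2 ^ n + z) (+-identityʳ (2 ^ n)) ⟨
  2 ^ suc n       ∎
  where open ≤-Reasoning

-- 1 + v ≤ k (1 + ⌊v / k⌋) ≤ k 2^⌊v / k⌋.
[1+v]^k≤k^k*2^v : ∀ k .{{_ : NonZero k}} v → suc v ^ k ≤ k ^ k * 2 ^ v
[1+v]^k≤k^k*2^v k v = begin
  suc v ^ k                     ≤⟨ ^-monoˡ-≤ k 1+v≤ ⟩
  (k * 2 ^ (v ℕ./ k)) ^ k       ≡⟨ ^-distribʳ-* k (2 ^ (v ℕ./ k)) k ⟩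
  k ^ k * (2 ^ (v ℕ./ k)) ^ k   ≡⟨ cong (k ^ k *_) (^-*-assoc 2 (v ℕ./ k) k) ⟩
  k ^ k * 2 ^ (v ℕ./ k * k)     ≤⟨ *-monoʳ-≤ (k ^ k) (^-monoʳ-≤ 2 (m/n*n≤m v k)) ⟩
  k ^ k * 2 ^ v                 ∎
  where
  open ≤-Reasoning
  1+v≤ : suc v ≤ k * 2 ^ (v ℕ./ k)
  1+v≤ = begin
    suc v                      ≡⟨ cong suc (m≡m%n+[m/n]*n v k) ⟩
    suc (v % k) + v ℕ./ k * k  ≤⟨ +-monoˡ-≤ (v ℕ./ k * k) (m%n<n v k) ⟩
    suc (v ℕ./ k) * k          ≤⟨ *-monoˡ-≤ k (1+n≤2^n (v ℕ./ k)) ⟩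
    2 ^ (v ℕ./ k) * k          ≡⟨ *-comm (2 ^ (v ℕ./ k)) k ⟩
    k * 2 ^ (v ℕ./ k)          ∎

-- The divisor bound.

prime∧∤⇒coprime : ∀ {p n} → Prime p → p ∤ n → Coprime n p
prime∧∤⇒coprime pp p∤n (d∣n , d∣p) with prime⇒irreducible pp d∣p
... | inj₁ d≡1  = d≡1
... | inj₂ refl = contradiction d∣n p∤n

-- Induction on `v`. If `p` divides `d`, cancel one `p` from both; otherwise `d` is coprime to `p`
-- and still divides the product after one factor `p` is dropped.
∣p^v*m⇒ : ∀ {p} → Prime p → ∀ v {m d} → d ∣ p ^ v * m →
          Σ[ i ∈ Fin (suc v) ] ∃[ e ] e ∣ m × d ≡ p ^ toℕ i * e
∣p^v*m⇒ pp zero {m} {d} d∣ =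
  Fin.zero , d , subst (d ∣_) (+-identityʳ m) d∣ , sym (+-identityʳ d)
∣p^v*m⇒ {p} pp (suc v) {m} {d} d∣ with p ∣? d
... | no p∤d =
  let i , e , e∣m , d≡ = ∣p^v*m⇒ pp v (coprime-divisor (prime∧∤⇒coprime pp p∤d)
        (subst (d ∣_) (*-assoc p (p ^ v) m) d∣))
  in Fin.inject₁ i , e , e∣m
     , trans d≡ (cong (λ j → p ^ j * e) (sym (Fin.toℕ-inject₁ i)))
... | yes (divides-refl q) =
  let i , e , e∣m , q≡ = ∣p^v*m⇒ pp v (*-cancelˡ-∣ p {{prime⇒nonZero pp}}
        (subst₂ _∣_ (*-comm q p) (*-assoc p (p ^ v) m) d∣))
  in Fin.suc i , e , e∣m , (begin
       q * p                    ≡⟨ *-comm q p ⟩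
       p * q                    ≡⟨ cong (p *_) q≡ ⟩
       p * (p ^ toℕ i * e)      ≡⟨ *-assoc p (p ^ toℕ i) e ⟨
       p * p ^ toℕ i * e        ∎)
  where open ≡-Reasoning

atMostDivisors-p^v* : ∀ {p} → Prime p → ∀ v {m l} →
                      AtMost l (_∣ m) → AtMost (suc v * l) (_∣ p ^ v * m)
atMostDivisors-p^v* {p} pp v {m} c = atMost-fibres
  {U = λ _ → ⊤} {R = λ i d → ∃[ e ] e ∣ m × d ≡ p ^ toℕ i * e}
  (λ d∣ → let i , r = ∣p^v*m⇒ pp v d∣ in i , tt , r)
  atMost-Fin
  (λ i → atMost-image (p ^ toℕ i *_) (λ r → r) c)

-- Every prime factor is at least 2 ^ k, so 2 ^ Ω(n) bounds the number of
-- divisors and its k-th power is at most n.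
rough-divisorBound : ∀ k (ps : List ℕ) → All Prime ps → All (2 ^ k ≤_) ps →
                     ∃[ l ] AtMost l (_∣ product ps) × l ^ k ≤ product ps
rough-divisorBound k [] [] [] =
  1 , atMost-1 (λ d∣1 e∣1 → trans (∣1⇒≡1 d∣1) (sym (∣1⇒≡1 e∣1))) , ≤-reflexive (^-zeroˡ k)
rough-divisorBound k (p ∷ ps) (pp ∷ pps) (k≤p ∷ k≤ps) =
  let l , c , l^k≤ = rough-divisorBound k ps pps k≤ps in
  -- Primes are split off one copy at a time, repeated ones too, and each copy at most doubles the
  -- count.
  2 * l
  , subst (λ q → AtMost (2 * l) (_∣ q * product ps)) (*-identityʳ p)
      (atMostDivisors-p^v* pp 1 c)
  , (begin
      (2 * l) ^ k      ≡⟨ ^-distribʳ-* 2 l k ⟩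
      2 ^ k * l ^ k    ≤⟨ *-mono-≤ k≤p l^k≤ ⟩
      p * product ps   ∎)
  where open ≤-Reasoning

-- The number of divisors is O(n^(1/k)) for `n` without prime factors below `j`. Lowering `j` one
-- step at a time treats the small primes separately.
RoughDivisorBound : ℕ → ℕ → Set
RoughDivisorBound k j = ∃[ C ] (∀ n .{{_ : NonZero n}} → j Rough n →
  ∃[ l ] AtMost l (_∣ n) × l ^ k ≤ C * n)

roughDivisorBound-2^k : ∀ k j → 2 ^ k ≤ j → RoughDivisorBound k j
roughDivisorBound-2^k k j 2^k≤j = 1 , bound
  where
  prime-divisor≥ : ∀ {n p} → j Rough n → Prime p → p ∣ n → 2 ^ k ≤ p
  prime-divisor≥ rough pp p∣n = ≮⇒≥ λ p<2^k →
    rough (hasNonTrivialDivisor {{prime⇒nonTrivial pp}} (<-≤-trans p<2^k 2^k≤j) p∣n)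

  all≥ : ∀ {n} ps → All Prime ps → j Rough n → product ps ∣ n → All (2 ^ k ≤_) ps
  all≥ [] [] rough _ = []
  all≥ (p ∷ ps) (pp ∷ pps) rough ps∣n =
    prime-divisor≥ rough pp (m*n∣⇒m∣ p (product ps) ps∣n)
    ∷ all≥ ps pps rough (m*n∣⇒n∣ p (product ps) ps∣n)

  bound : ∀ n .{{_ : NonZero n}} → j Rough n → ∃[ l ] AtMost l (_∣ n) × l ^ k ≤ 1 * n
  bound n rough =
    let ps , n≡ , pps = fac
        l , c , l^k≤ = rough-divisorBound k ps pps (all≥ ps pps rough (∣-reflexive (sym n≡)))
    in l , subst (λ m → AtMost l (_∣ m)) (sym n≡) c
     , subst (l ^ k ≤_) (trans (sym n≡) (sym (*-identityˡ n))) l^k≤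
    where
    fac : ∃[ ps ] n ≡ product ps × All Prime ps
    fac = let open PrimeFactorisation (factorise n) in factors , isFactorisation , factorsPrime

p-part : ∀ p .{{_ : NonTrivial p}} n .{{_ : NonZero n}} → ∃[ v ] ∃[ m ] n ≡ p ^ v * m × p ∤ m
p-part p = <-rec (λ n → .{{_ : NonZero n}} → ∃[ v ] ∃[ m ] n ≡ p ^ v * m × p ∤ m) step
  where
  step : ∀ n → (∀ {m} → m < n → .{{_ : NonZero m}} → ∃[ v ] ∃[ o ] m ≡ p ^ v * o × p ∤ o) →
         .{{_ : NonZero n}} → ∃[ v ] ∃[ m ] n ≡ p ^ v * m × p ∤ m
  step n rec with p ∣? n
  ... | no p∤n = 0 , n , sym (+-identityʳ n) , p∤n
  ... | yes p∣n =
    let instance _ = quotient≢0 p∣n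
        v , m , q≡ , p∤m = rec (quotient-< p∣n)
    in suc v , m
     , trans (m∣n⇒n≡m*quotient p∣n) (trans (cong (p *_) q≡) (sym (*-assoc p (p ^ v) m)))
     , p∤m

-- If `j` divides a `j`-rough number, then `j` is prime, and splitting off its full power j^v leaves
-- a cofactor that is rough at `suc j`. The extra factor (1 + v)^k is at most k^k 2^v, hence at most
-- k^k j^v, and j^v is part of `n`; so each step costs k^k in the constant.
roughDivisorBound-pred : ∀ k .{{_ : NonZero k}} j .{{_ : NonTrivial j}} →
                         RoughDivisorBound k (suc j) → RoughDivisorBound k j
roughDivisorBound-pred k j (C , bound) = k ^ k * C , bound′
  where
  open ≤-Reasoning

  bound′ : ∀ n .{{_ : NonZero n}} → j Rough n → ∃[ l ] AtMost l (_∣ n) × l ^ k ≤ k ^ k * C * n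
  bound′ n rough with j ∣? n
  ... | no j∤n =
    let l , c , l^k≤ = bound n (∤⇒rough-suc j∤n rough)
    in l , c , (begin
      l ^ k            ≤⟨ l^k≤ ⟩
      C * n            ≤⟨ m≤n*m (C * n) (k ^ k) {{m^n≢0 k k}} ⟩
      k ^ k * (C * n)  ≡⟨ *-assoc (k ^ k) C n ⟨
      k ^ k * C * n    ∎)
  ... | yes j∣n with p-part j n
  ...   | v , m , refl , j∤m =
    let instance
          m≢0 : NonZero m
          m≢0 = m*n≢0⇒n≢0 (j ^ v)
        l , c , l^k≤ = bound m (∤⇒rough-suc j∤m (rough∧∣⇒rough rough (n∣m*n (j ^ v))))
    in suc v * l
     , atMostDivisors-p^v* (rough∧∣⇒prime rough j∣n) v c
     , (begin
         (suc v * l) ^ k                ≡⟨ ^-distribʳ-* (suc v) l k ⟩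
         suc v ^ k * l ^ k              ≤⟨ *-mono-≤ ([1+v]^k≤k^k*2^v k v) l^k≤ ⟩
         k ^ k * 2 ^ v * (C * m)        ≤⟨ *-monoˡ-≤ (C * m) (*-monoʳ-≤ (k ^ k)
                                             (^-monoˡ-≤ v (nonTrivial⇒n>1 j))) ⟩
         k ^ k * j ^ v * (C * m)        ≡⟨ [m*n]*[o*p]≡[m*o]*[n*p] (k ^ k) (j ^ v) C m ⟩
         k ^ k * C * (j ^ v * m)        ∎)

divisorBound : ∀ k .{{_ : NonZero k}} →
               ∃[ C ] (∀ n .{{_ : NonZero n}} → ∃[ l ] AtMost l (_∣ n) × l ^ k ≤ C * n)
divisorBound k =
  -- Starting at 2 + 2^k keeps every `j` of the descent at least 2; at the end, 2-roughness holds
  -- for every number.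
  let C , bound = descend (2 ^ k) (roughDivisorBound-2^k k (2 + 2 ^ k) (m≤n+m (2 ^ k) 2))
  in C , λ n → bound n 2-rough
  where
  descend : ∀ i → RoughDivisorBound k (2 + i) → RoughDivisorBound k 2
  descend zero    b = b
  descend (suc i) b = descend i (roughDivisorBound-pred k (2 + i) b)

-- A single `l` for all `n` up to `X`: the maximum of the individual bounds, which inherits the
-- power bound because it is one of them.
uniformDivisorBound : ∀ k .{{_ : NonZero k}} →
  ∃[ C ] (∀ X → ∃[ l ] (∀ n .{{_ : NonZero n}} → n ≤ X → AtMost l (_∣ n)) × l ^ k ≤ C * X)
uniformDivisorBound k@(suc _) =
  let C , bound = divisorBound k in C , uniform C bound
  where
  uniform : ∀ C → (∀ n .{{_ : NonZero n}} → ∃[ l ] AtMost l (_∣ n) × l ^ k ≤ C * n) →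
            ∀ X → ∃[ l ] (∀ n .{{_ : NonZero n}} → n ≤ X → AtMost l (_∣ n)) × l ^ k ≤ C * X
  -- There is no positive `n` up to 0, so `l` can be 0; `k` is a successor, so 0^k is 0.
  uniform C bound zero = 0 , (λ { (suc _) () }) , z≤n
  uniform C bound (suc X) with uniform C bound X | bound (suc X)
  ... | l , c , l^k≤ | m , d , m^k≤ = l ⊔ m , c′ , ⊔^k≤
    where
    c′ : ∀ n .{{_ : NonZero n}} → n ≤ suc X → AtMost (l ⊔ m) (_∣ n)
    c′ n n≤1+X with m≤n⇒m<n∨m≡n n≤1+X
    ... | inj₁ n<1+X = atMost-≤ (m≤m⊔n l m) (c n (s≤s⁻¹ n<1+X))
    ... | inj₂ refl  = atMost-≤ (m≤n⊔m l m) d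
    ⊔^k≤ : (l ⊔ m) ^ k ≤ C * suc X
    ⊔^k≤ with ⊔-sel l m
    ... | inj₁ eq rewrite eq = ≤-trans l^k≤ (*-monoʳ-≤ C (n≤1+n X))
    ... | inj₂ eq rewrite eq = m^k≤

-- Integer divisors of both signs and the interval [1, P].

atMost-∣∣≡ : ∀ n → AtMost 2 (λ i → ℤ.∣ i ∣ ≡ n)
atMost-∣∣≡ n = atMost-⊎ {T = ℤ.+ n ≡_} {U = λ i → ℤ.+ n ≡ ℤ.- i}
  (λ { {i} refl → ℤ.+∣i∣≡i⊎+∣i∣≡-i i })
  (atMost-1 (λ p q → trans (sym p) q))
  (atMost-1 (λ p q → ℤ.neg-injective (trans (sym p) q)))

atMost-ℤdivisors : ∀ {l n} → AtMost l (_∣ n) → AtMost (l * 2) (λ i → ℤ.∣ i ∣ ∣ n)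
atMost-ℤdivisors c = atMost-fibres (λ {i} i∣n → ℤ.∣ i ∣ , i∣n , refl) c atMost-∣∣≡

Range : ℕ → ℤ → Set
Range P z = Σ[ i ∈ Fin P ] z ≡ + suc (toℕ i)

atMost-Range : ∀ {P} → AtMost P (Range P)
atMost-Range = encode proj₁ λ { (i , refl) (i , refl) refl → refl }

∣i-j∣≤P : ∀ {P i j} → Range P i → Range P j → ℤ.∣ i ℤ.- j ∣ ≤ P
∣i-j∣≤P {P} (i , refl) (j , refl) = begin
  ℤ.∣ + suc (toℕ i) ℤ.- + suc (toℕ j) ∣  ≡⟨ cong ℤ.∣_∣ (ℤ.m-n≡m⊖n (suc (toℕ i)) (suc (toℕ j))) ⟩
  ℤ.∣ suc (toℕ i) ℤ.⊖ suc (toℕ j) ∣      ≤⟨ ℤ.∣m⊝n∣≤m⊔n (suc (toℕ i)) (suc (toℕ j)) ⟩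
  suc (toℕ i) ⊔ suc (toℕ j)              ≤⟨ ⊔-lub (Fin.toℕ<n i) (Fin.toℕ<n j) ⟩
  P                                      ∎
  where open ≤-Reasoning

-- The system in n pairs of variables and the removal of one pair.

Pair : ℕ → Set
Pair n = Vec ℤ n × Vec ℤ n

record Sol {n} (P : ℕ) (h : Fin 3 → ℤ) (xy : Pair n) : Set where
  constructor sol
  field
    x-range   : ∀ i → Range P (lookup (proj₁ xy) i)
    y-range   : ∀ i → Range P (lookup (proj₂ xy) i)
    equations : ∀ j → powerDifference (suc (toℕ j)) (proj₁ xy) (proj₂ xy) ≡ h j

open Sol

Disjoint : ∀ {n} → Pair n → Set
Disjoint (x , y) = ∀ i k → lookup x i ≢ lookup y k

-- The right-hand side that remains when `s` among the x and `t` among the y are moved across.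
shift : (Fin 3 → ℤ) → ℤ → ℤ → Fin 3 → ℤ
shift h s t j = h j ℤ.- (s ℤ.^ suc (toℕ j) ℤ.- t ℤ.^ suc (toℕ j))

remove : ∀ {n} → Fin (suc n) → Fin (suc n) → Pair (suc n) → Pair n
remove i k (x , y) = removeAt x i , removeAt y k

lookup-removeAt : ∀ {A : Set} {n} (xs : Vec A (suc n)) i j →
                  lookup (removeAt xs i) j ≡ lookup xs (punchIn i j)
lookup-removeAt (x ∷ xs)     0F          j           = refl
lookup-removeAt (x ∷ _ ∷ _)  (Fin.suc i) 0F          = refl
lookup-removeAt (x ∷ y ∷ xs) (Fin.suc i) (Fin.suc j) = lookup-removeAt (y ∷ xs) i j

-- `powerDifference` pairs entries at equal positions. Separate sums over x and y allow removal at
-- two different positions.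
powerSum : ∀ {n} → ℕ → Vec ℤ n → ℤ
powerSum j []       = 0ℤ
powerSum j (x ∷ xs) = x ℤ.^ j ℤ.+ powerSum j xs

powerDifference≡ : ∀ {n} j (x y : Vec ℤ n) → powerDifference j x y ≡ powerSum j x ℤ.- powerSum j y
powerDifference≡ j []       []       = refl
powerDifference≡ j (x ∷ xs) (y ∷ ys) = trans
  (cong (λ z → (x ℤ.^ j ℤ.- y ℤ.^ j) ℤ.+ z) (powerDifference≡ j xs ys))
  (lemma (x ℤ.^ j) (y ℤ.^ j) (powerSum j xs) (powerSum j ys))
  where
  lemma : ∀ a b c d → (a ℤ.- b) ℤ.+ (c ℤ.- d) ≡ (a ℤ.+ c) ℤ.- (b ℤ.+ d)
  lemma = ℤSolver.solve-∀

powerSum-removeAt : ∀ {n} j (x : Vec ℤ (suc n)) i →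
                    powerSum j x ≡ lookup x i ℤ.^ j ℤ.+ powerSum j (removeAt x i)
powerSum-removeAt j (x ∷ xs)     0F          = refl
powerSum-removeAt j (x ∷ y ∷ xs) (Fin.suc i) =
  trans (cong (λ z → x ℤ.^ j ℤ.+ z) (powerSum-removeAt j (y ∷ xs) i))
    (lemma (x ℤ.^ j) (lookup (y ∷ xs) i ℤ.^ j) (powerSum j (removeAt (y ∷ xs) i)))
  where
  lemma : ∀ a b c → a ℤ.+ (b ℤ.+ c) ≡ b ℤ.+ (a ℤ.+ c)
  lemma = ℤSolver.solve-∀

powerDifference-removeAt : ∀ {n} j (x y : Vec ℤ (suc n)) i k →
  powerDifference j (removeAt x i) (removeAt y k) ≡
  powerDifference j x y ℤ.- (lookup x i ℤ.^ j ℤ.- lookup y k ℤ.^ j)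
powerDifference-removeAt j x y i k
  rewrite powerDifference≡ j (removeAt x i) (removeAt y k) | powerDifference≡ j x y
        | powerSum-removeAt j x i | powerSum-removeAt j y k =
  lemma (lookup x i ℤ.^ j) (lookup y k ℤ.^ j) (powerSum j (removeAt x i)) (powerSum j (removeAt y k))
  where
  lemma : ∀ a b c d → c ℤ.- d ≡ ((a ℤ.+ c) ℤ.- (b ℤ.+ d)) ℤ.- (a ℤ.- b)
  lemma = ℤSolver.solve-∀

module _ {n P : ℕ} {h : Fin 3 → ℤ} {xy : Pair (suc n)} (i k : Fin (suc n)) where

  sol-remove : Sol P h xy →
               Sol P (shift h (lookup (proj₁ xy) i) (lookup (proj₂ xy) k)) (remove i k xy)
  sol-remove (sol rx ry eqs) = sol
    (λ j → subst (Range P) (sym (lookup-removeAt x i j)) (rx (punchIn i j)))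
    (λ j → subst (Range P) (sym (lookup-removeAt y k j)) (ry (punchIn k j)))
    (λ j → trans (powerDifference-removeAt (suc (toℕ j)) x y i k)
      (cong (ℤ._- (lookup x i ℤ.^ suc (toℕ j) ℤ.- lookup y k ℤ.^ suc (toℕ j))) (eqs j)))
    where
    x = proj₁ xy
    y = proj₂ xy

  -- Equal variables cancel in every equation, so the right-hand side stays the same.
  sol-remove-≡ : lookup (proj₁ xy) i ≡ lookup (proj₂ xy) k → Sol P h xy → Sol P h (remove i k xy)
  sol-remove-≡ x≡y s = let sol rx ry eqs = sol-remove s in sol rx ry λ j → trans (eqs j)
    (trans (cong (λ z → h j ℤ.- (lookup (proj₁ xy) i ℤ.^ suc (toℕ j) ℤ.- z ℤ.^ suc (toℕ j))) (sym x≡y))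
      (lemma (h j) (lookup (proj₁ xy) i ℤ.^ suc (toℕ j))))
    where
    lemma : ∀ a b → a ℤ.- (b ℤ.- b) ≡ a
    lemma = ℤSolver.solve-∀

disjoint-remove : ∀ {n} {xy : Pair (suc n)} i k → Disjoint xy → Disjoint (remove i k xy)
disjoint-remove {xy = x , y} i k x≢y i′ k′ eq = x≢y (punchIn i i′) (punchIn k k′)
  (trans (sym (lookup-removeAt x i i′)) (trans eq (lookup-removeAt y k k′)))

-- Reinserting the known values `s` and `t` recovers the pair from what is left, so removal loses no
-- information.
atMost-remove : ∀ {n m s t} i k {S : Pair (suc n) → Set} {T : Pair n → Set} →
  (∀ {xy} → S xy → lookup (proj₁ xy) i ≡ s × lookup (proj₂ xy) k ≡ t × T (remove i k xy)) →
  AtMost m T → AtMost m S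
atMost-remove {s = s} {t} i k S⊆T =
  atMost-image (λ (x , y) → insertAt x i s , insertAt y k t)
    λ {xy} Sxy → let x≡s , y≡t , Txy = S⊆T Sxy in remove i k xy , Txy , cong₂ _,_
      (trans (sym (insertAt-removeAt (proj₁ xy) i)) (cong (insertAt _ i) x≡s))
      (trans (sym (insertAt-removeAt (proj₂ xy) k)) (cong (insertAt _ k) y≡t))

-- A solution with a coincidence is encoded by the two positions, the common value and the solution
-- left after cancelling it.
sol-overlap : ∀ {n P h m} → AtMost m (Sol {n} P h) →
  AtMost (suc n * (suc n * (P * m)))
    (λ xy → Sol {suc n} P h xy × ∃₂ λ i k → lookup (proj₁ xy) i ≡ lookup (proj₂ xy) k)
sol-overlap {n} {P} {h} c =
  atMost-fibres
    {R = λ i xy → Sol {suc n} P h xy × ∃[ k ] lookup (proj₁ xy) i ≡ lookup (proj₂ xy) k}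
    (λ (s , i , r) → i , tt , s , r) atMost-Fin λ i →
  atMost-fibres
    {R = λ k xy → Sol {suc n} P h xy × lookup (proj₁ xy) i ≡ lookup (proj₂ xy) k}
    (λ (s , k , r) → k , tt , s , r) atMost-Fin λ k →
  atMost-fibres
    {R = λ z xy → Sol {suc n} P h xy × lookup (proj₁ xy) i ≡ lookup (proj₂ xy) k
                    × lookup (proj₁ xy) i ≡ z}
    (λ {xy} (s , x≡y) → lookup (proj₁ xy) i , x-range s i , s , x≡y , refl) atMost-Range λ z →
  atMost-remove {s = z} {t = z} i k
    (λ (s , x≡y , x≡z) → x≡z , trans (sym x≡y) x≡z , sol-remove-≡ i k x≡y s) c

overlap⊎disjoint : ∀ {n} (xy : Pair n) →
  (∃₂ λ i k → lookup (proj₁ xy) i ≡ lookup (proj₂ xy) k) ⊎ Disjoint xy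
overlap⊎disjoint (x , y) with Fin.any? (λ i → Fin.any? (λ k → lookup x i ℤ.≟ lookup y k))
... | yes p = inj₁ p
... | no ¬p = inj₂ λ i k x≡y → ¬p (i , k , x≡y)

-- One pair of variables.

Nonzero : (Fin 3 → ℤ) → Set
Nonzero h = ¬ (∀ j → h j ≡ 0ℤ)

*-cancelˡ-2* : ∀ {h s t} → h ≢ 0ℤ → h ℤ.* (+ 2 ℤ.* s) ≡ h ℤ.* (+ 2 ℤ.* t) → s ≡ t
*-cancelˡ-2* {h} {s} {t} h≢0 eq = ℤ.*-cancelˡ-≡ (+ 2) s t
  (ℤ.*-cancelˡ-≡ h (+ 2 ℤ.* s) (+ 2 ℤ.* t) {{ℤ.≢-nonZero h≢0}} eq)

-- Here `h 0F` is x - y, which cannot vanish, since x = y would make all of `h` zero. Then 2 y (x -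
-- y) = `h 1F` - (`h 0F`)^2 fixes y, and so x.
atMost-Sol₁ : ∀ {P h} → Nonzero h → AtMost 1 (Sol {1} P h)
atMost-Sol₁ {P} {h} h≢0 = atMost-1 unique
  where
  h₀≢0 : ∀ {xy : Pair 1} → Sol P h xy → h 0F ≢ 0ℤ
  h₀≢0 {x ∷ [] , y ∷ []} (sol _ _ eqs) h₀≡0 = h≢0 λ j →
    trans (sym (eqs j)) (trans (cong (λ z → z ℤ.^ suc (toℕ j) ℤ.- y ℤ.^ suc (toℕ j) ℤ.+ 0ℤ) x≡y)
      (lemma (y ℤ.^ suc (toℕ j))))
    where
    lemma : ∀ a → a ℤ.- a ℤ.+ 0ℤ ≡ 0ℤ
    lemma = ℤSolver.solve-∀
    x≡y : x ≡ y
    x≡y = ℤ.i-j≡0⇒i≡j x y (trans (identity x y) (trans (eqs 0F) h₀≡0))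
      where
      identity : ∀ x y → x ℤ.- y ≡ (x ℤ.* 1ℤ ℤ.- y ℤ.* 1ℤ) ℤ.+ 0ℤ
      identity = ℤSolver.solve-∀

  -- The ring solver does not see through ℤ._^_, so the identities below are
  -- stated in terms of the products to which the powers reduce.
  h₀*2y : ∀ {x y} → Sol P h (x ∷ [] , y ∷ []) → h 0F ℤ.* (+ 2 ℤ.* y) ≡ h 1F ℤ.- h 0F ℤ.* h 0F
  h₀*2y {x} {y} (sol _ _ eqs) rewrite sym (eqs 0F) | sym (eqs 1F) = identity x y
    where
    identity : ∀ x y →
      let h₀ = (x ℤ.* 1ℤ ℤ.- y ℤ.* 1ℤ) ℤ.+ 0ℤ
          h₁ = (x ℤ.* (x ℤ.* 1ℤ) ℤ.- y ℤ.* (y ℤ.* 1ℤ)) ℤ.+ 0ℤ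
      in h₀ ℤ.* (+ 2 ℤ.* y) ≡ h₁ ℤ.- h₀ ℤ.* h₀
    identity = ℤSolver.solve-∀

  x≡y+h₀ : ∀ {x y} → Sol P h (x ∷ [] , y ∷ []) → x ≡ y ℤ.+ h 0F
  x≡y+h₀ {x} {y} (sol _ _ eqs) rewrite sym (eqs 0F) = identity x y
    where
    identity : ∀ x y → x ≡ y ℤ.+ ((x ℤ.* 1ℤ ℤ.- y ℤ.* 1ℤ) ℤ.+ 0ℤ)
    identity = ℤSolver.solve-∀

  unique : ∀ {xy x′y′ : Pair 1} → Sol P h xy → Sol P h x′y′ → xy ≡ x′y′
  unique {x ∷ [] , y ∷ []} {x′ ∷ [] , y′ ∷ []} s s′
    with *-cancelˡ-2* {t = y′} (h₀≢0 s) (trans (h₀*2y s) (sym (h₀*2y s′)))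
  ... | refl with trans (x≡y+h₀ s) (sym (x≡y+h₀ s′))
  ...   | refl = refl

-- Two pairs of variables: the resultant and its divisors.

-- Twelve times the resultant of the quadratics with roots x₁, x₂ and y₁, y₂.
resultant : (Fin 3 → ℤ) → ℤ
resultant h = h 0F ℤ.* h 0F ℤ.* h 0F ℤ.* h 0F ℤ.- + 4 ℤ.* h 0F ℤ.* h 2F ℤ.+ + 3 ℤ.* h 1F ℤ.* h 1F

resultant≡ : ∀ {P h x₁ x₂ y₁ y₂} → Sol P h (x₁ ∷ x₂ ∷ [] , y₁ ∷ y₂ ∷ []) →
  resultant h ≡ + 12 ℤ.* ((x₁ ℤ.- y₁) ℤ.* ((x₂ ℤ.- y₁) ℤ.* ((x₁ ℤ.- y₂) ℤ.* (x₂ ℤ.- y₂))))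
resultant≡ {x₁ = x₁} {x₂} {y₁} {y₂} (sol _ _ eqs)
  rewrite sym (eqs 0F) | sym (eqs 1F) | sym (eqs 2F) = identity x₁ x₂ y₁ y₂
  where
  identity : ∀ x₁ x₂ y v →
    let h₁ = (x₁ ℤ.* 1ℤ ℤ.- y ℤ.* 1ℤ) ℤ.+ ((x₂ ℤ.* 1ℤ ℤ.- v ℤ.* 1ℤ) ℤ.+ 0ℤ)
        h₂ = (x₁ ℤ.* (x₁ ℤ.* 1ℤ) ℤ.- y ℤ.* (y ℤ.* 1ℤ))
               ℤ.+ ((x₂ ℤ.* (x₂ ℤ.* 1ℤ) ℤ.- v ℤ.* (v ℤ.* 1ℤ)) ℤ.+ 0ℤ)
        h₃ = (x₁ ℤ.* (x₁ ℤ.* (x₁ ℤ.* 1ℤ)) ℤ.- y ℤ.* (y ℤ.* (y ℤ.* 1ℤ)))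
               ℤ.+ ((x₂ ℤ.* (x₂ ℤ.* (x₂ ℤ.* 1ℤ)) ℤ.- v ℤ.* (v ℤ.* (v ℤ.* 1ℤ))) ℤ.+ 0ℤ)
    in h₁ ℤ.* h₁ ℤ.* h₁ ℤ.* h₁ ℤ.- + 4 ℤ.* h₁ ℤ.* h₃ ℤ.+ + 3 ℤ.* h₂ ℤ.* h₂
       ≡ + 12 ℤ.* ((x₁ ℤ.- y) ℤ.* ((x₂ ℤ.- y) ℤ.* ((x₁ ℤ.- v) ℤ.* (x₂ ℤ.- v))))
  identity = ℤSolver.solve-∀

DisjointSol : ∀ {n} → ℕ → (Fin 3 → ℤ) → Pair n → Set
DisjointSol P h xy = Sol P h xy × Disjoint xy

-- The two factors of the resultant that contain y₁.
Δ₁ Δ₂ : Pair 2 → ℤ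
Δ₁ (x , y) = lookup x 0F ℤ.- lookup y 0F
Δ₂ (x , y) = lookup x 1F ℤ.- lookup y 0F

module _ {P : ℕ} {h : Fin 3 → ℤ} where

  resultant≢0 : ∀ {xy} → DisjointSol {2} P h xy → resultant h ≢ 0ℤ
  resultant≢0 {x₁ ∷ x₂ ∷ [] , y₁ ∷ y₂ ∷ []} (s , x≢y) eq
    with ℤ.i*j≡0⇒i≡0∨j≡0 (+ 12) (trans (sym (resultant≡ s)) eq)
  ... | inj₂ eq₁ with ℤ.i*j≡0⇒i≡0∨j≡0 (x₁ ℤ.- y₁) eq₁
  ...   | inj₁ z   = x≢y 0F 0F (ℤ.i-j≡0⇒i≡j _ _ z)
  ...   | inj₂ eq₂ with ℤ.i*j≡0⇒i≡0∨j≡0 (x₂ ℤ.- y₁) eq₂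
  ...     | inj₁ z   = x≢y 1F 0F (ℤ.i-j≡0⇒i≡j _ _ z)
  ...     | inj₂ eq₃ with ℤ.i*j≡0⇒i≡0∨j≡0 (x₁ ℤ.- y₂) eq₃
  ...       | inj₁ z = x≢y 0F 1F (ℤ.i-j≡0⇒i≡j _ _ z)
  ...       | inj₂ z = x≢y 1F 1F (ℤ.i-j≡0⇒i≡j _ _ z)

  ∣resultant∣≡ : ∀ {x₁ x₂ y₁ y₂} → Sol P h (x₁ ∷ x₂ ∷ [] , y₁ ∷ y₂ ∷ []) →
    ℤ.∣ resultant h ∣ ≡
    12 * (ℤ.∣ x₁ ℤ.- y₁ ∣ * (ℤ.∣ x₂ ℤ.- y₁ ∣ * (ℤ.∣ x₁ ℤ.- y₂ ∣ * ℤ.∣ x₂ ℤ.- y₂ ∣)))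
  ∣resultant∣≡ {x₁} {x₂} {y₁} {y₂} s = begin
    ℤ.∣ resultant h ∣          ≡⟨ cong ℤ.∣_∣ (resultant≡ s) ⟩
    ℤ.∣ + 12 ℤ.* (a ℤ.* (b ℤ.* (c ℤ.* d))) ∣  ≡⟨ ℤ.abs-* (+ 12) (a ℤ.* (b ℤ.* (c ℤ.* d))) ⟩
    12 * ℤ.∣ a ℤ.* (b ℤ.* (c ℤ.* d)) ∣        ≡⟨ cong (12 *_) (ℤ.abs-* a (b ℤ.* (c ℤ.* d))) ⟩
    12 * (ℤ.∣ a ∣ * ℤ.∣ b ℤ.* (c ℤ.* d) ∣)
      ≡⟨ cong (λ z → 12 * (ℤ.∣ a ∣ * z)) (ℤ.abs-* b (c ℤ.* d)) ⟩
    12 * (ℤ.∣ a ∣ * (ℤ.∣ b ∣ * ℤ.∣ c ℤ.* d ∣))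
      ≡⟨ cong (λ z → 12 * (ℤ.∣ a ∣ * (ℤ.∣ b ∣ * z))) (ℤ.abs-* c d) ⟩
    12 * (ℤ.∣ a ∣ * (ℤ.∣ b ∣ * (ℤ.∣ c ∣ * ℤ.∣ d ∣)))  ∎
    where
    open ≡-Reasoning
    a = x₁ ℤ.- y₁
    b = x₂ ℤ.- y₁
    c = x₁ ℤ.- y₂
    d = x₂ ℤ.- y₂

  -- Any `h` that has a solution obeys this bound in `P` alone, which makes the divisor bound
  -- uniform in `h`.
  ∣resultant∣≤ : ∀ {xy} → Sol {2} P h xy → ℤ.∣ resultant h ∣ ≤ 12 * (P * (P * (P * P)))
  ∣resultant∣≤ {x₁ ∷ x₂ ∷ [] , y₁ ∷ y₂ ∷ []} s@(sol rx ry _) = begin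
    ℤ.∣ resultant h ∣  ≡⟨ ∣resultant∣≡ s ⟩
    12 * (ℤ.∣ x₁ ℤ.- y₁ ∣ * (ℤ.∣ x₂ ℤ.- y₁ ∣ * (ℤ.∣ x₁ ℤ.- y₂ ∣ * ℤ.∣ x₂ ℤ.- y₂ ∣)))
      ≤⟨ *-monoʳ-≤ 12 (*-mono-≤ (∣i-j∣≤P (rx 0F) (ry 0F)) (*-mono-≤ (∣i-j∣≤P (rx 1F) (ry 0F))
           (*-mono-≤ (∣i-j∣≤P (rx 0F) (ry 1F)) (∣i-j∣≤P (rx 1F) (ry 1F))))) ⟩
    12 * (P * (P * (P * P)))  ∎
    where open ≤-Reasoning

  Δ₁∣resultant : ∀ {xy} → Sol {2} P h xy → ℤ.∣ Δ₁ xy ∣ ∣ ℤ.∣ resultant h ∣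
  Δ₁∣resultant {x₁ ∷ x₂ ∷ [] , y₁ ∷ y₂ ∷ []} s = subst (ℤ.∣ x₁ ℤ.- y₁ ∣ ∣_) (sym (∣resultant∣≡ s))
    (∣n⇒∣m*n 12 (m∣m*n _))

  Δ₂∣resultant : ∀ {xy} → Sol {2} P h xy → ℤ.∣ Δ₂ xy ∣ ∣ ℤ.∣ resultant h ∣
  Δ₂∣resultant {x₁ ∷ x₂ ∷ [] , y₁ ∷ y₂ ∷ []} s = subst (ℤ.∣ x₂ ℤ.- y₁ ∣ ∣_) (sym (∣resultant∣≡ s))
    (∣n⇒∣m*n 12 (∣n⇒∣m*n ℤ.∣ x₁ ℤ.- y₁ ∣ (m∣m*n _)))

  -- Adding y₁ to the differences gives x₁ and x₂, and the linear equation then gives y₂.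
  Δ-y₁-determine : ∀ {xy x′y′} → Sol {2} P h xy → Sol P h x′y′ →
    Δ₁ xy ≡ Δ₁ x′y′ → Δ₂ xy ≡ Δ₂ x′y′ → lookup (proj₂ xy) 0F ≡ lookup (proj₂ x′y′) 0F → xy ≡ x′y′
  Δ-y₁-determine {x₁ ∷ x₂ ∷ [] , y₁ ∷ y₂ ∷ []} {x₁′ ∷ x₂′ ∷ [] , _ ∷ y₂′ ∷ []} s s′ eq₁ eq₂ refl
    with ∙-cancelʳ ℤ.+-0-abelianGroup (ℤ.- y₁) x₁ x₁′ eq₁
       | ∙-cancelʳ ℤ.+-0-abelianGroup (ℤ.- y₁) x₂ x₂′ eq₂
  ... | refl | refl with trans (y₂≡ s) (sym (y₂≡ s′))
    where
    y₂≡ : ∀ {x₁ x₂ y₁ y₂} → Sol P h (x₁ ∷ x₂ ∷ [] , y₁ ∷ y₂ ∷ []) → y₂ ≡ x₁ ℤ.+ x₂ ℤ.- y₁ ℤ.- h 0F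
    y₂≡ {x₁} {x₂} {y₁} {y₂} (sol _ _ eqs) rewrite sym (eqs 0F) = identity x₁ x₂ y₁ y₂
      where
      identity : ∀ x₁ x₂ y₁ y₂ → y₂ ≡ x₁ ℤ.+ x₂ ℤ.- y₁ ℤ.-
        ((x₁ ℤ.* 1ℤ ℤ.- y₁ ℤ.* 1ℤ) ℤ.+ ((x₂ ℤ.* 1ℤ ℤ.- y₂ ℤ.* 1ℤ) ℤ.+ 0ℤ))
      identity = ℤSolver.solve-∀
  ...   | refl = refl

  -- Put a = x₁ - y₁ and b = x₂ - y₁, so that y₂ = y₁ + a + b - `h 0F`. In the quadratic equation
  -- the terms in y₁^2 cancel, leaving a linear equation for y₁ with coefficient 2 `h 0F`.
  Δ-determine : ∀ {xy x′y′} → h 0F ≢ 0ℤ → Sol {2} P h xy → Sol P h x′y′ →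
    Δ₁ xy ≡ Δ₁ x′y′ → Δ₂ xy ≡ Δ₂ x′y′ → xy ≡ x′y′
  Δ-determine {xy} {x′y′} h₀≢0 s s′ eq₁ eq₂ = Δ-y₁-determine s s′ eq₁ eq₂
    (*-cancelˡ-2* h₀≢0 (trans (2h₀y₁≡ s) (trans (cong₂ F eq₁ eq₂) (sym (2h₀y₁≡ s′)))))
    where
    F : ℤ → ℤ → ℤ
    F a b = h 1F ℤ.- (a ℤ.* a ℤ.+ b ℤ.* b ℤ.- (a ℤ.+ b ℤ.- h 0F) ℤ.* (a ℤ.+ b ℤ.- h 0F))

    2h₀y₁≡ : ∀ {xy} → Sol {2} P h xy → h 0F ℤ.* (+ 2 ℤ.* lookup (proj₂ xy) 0F) ≡ F (Δ₁ xy) (Δ₂ xy)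
    2h₀y₁≡ {x₁ ∷ x₂ ∷ [] , y₁ ∷ y₂ ∷ []} (sol _ _ eqs)
      rewrite sym (eqs 0F) | sym (eqs 1F) = identity x₁ x₂ y₁ y₂
      where
      identity : ∀ x₁ x₂ y₁ y₂ →
        let h₁ = (x₁ ℤ.* 1ℤ ℤ.- y₁ ℤ.* 1ℤ) ℤ.+ ((x₂ ℤ.* 1ℤ ℤ.- y₂ ℤ.* 1ℤ) ℤ.+ 0ℤ)
            h₂ = (x₁ ℤ.* (x₁ ℤ.* 1ℤ) ℤ.- y₁ ℤ.* (y₁ ℤ.* 1ℤ))
                   ℤ.+ ((x₂ ℤ.* (x₂ ℤ.* 1ℤ) ℤ.- y₂ ℤ.* (y₂ ℤ.* 1ℤ)) ℤ.+ 0ℤ)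
            a = x₁ ℤ.- y₁
            b = x₂ ℤ.- y₁
        in h₁ ℤ.* (+ 2 ℤ.* y₁) ≡ h₂ ℤ.- (a ℤ.* a ℤ.+ b ℤ.* b ℤ.- (a ℤ.+ b ℤ.- h₁) ℤ.* (a ℤ.+ b ℤ.- h₁))
      identity = ℤSolver.solve-∀

-- Counting solutions in terms of P and a divisor bound L.

module Count {P L : ℕ} (divisors : ∀ n .{{_ : NonZero n}} → n ≤ 12 * (P * (P * (P * P))) →
                                   AtMost L (λ i → ℤ.∣ i ∣ ∣ n)) where

  -- If the resultant is zero or exceeds the bound, there are no disjoint solutions. Otherwise both
  -- differences are among its at most `L` integer divisors.
  atMost-Δ : ∀ {h} {S : Pair 2 → Set} → (∀ {xy} → S xy → DisjointSol P h xy) →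
    (∀ {xy x′y′} → S xy → S x′y′ → Δ₁ xy ≡ Δ₁ x′y′ → Δ₂ xy ≡ Δ₂ x′y′ → xy ≡ x′y′) →
    AtMost (L * (L * 1)) S
  atMost-Δ {h} {S} S⊆ determined
    with resultant h ℤ.≟ 0ℤ | ℤ.∣ resultant h ∣ ≤? 12 * (P * (P * (P * P)))
  ... | yes D≡0 | _ = atMost-∅ λ s → resultant≢0 (S⊆ s) D≡0
  ... | no _ | no D≰ = atMost-∅ λ s → D≰ (∣resultant∣≤ (proj₁ (S⊆ s)))
  ... | no D≢0 | yes D≤ =
    atMost-fibres {R = λ a xy → S xy × Δ₁ xy ≡ a}
      (λ {xy} s → Δ₁ xy , Δ₁∣resultant (proj₁ (S⊆ s)) , s , refl) D-divisors λ a →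
    atMost-fibres {R = λ b xy → S xy × Δ₁ xy ≡ a × Δ₂ xy ≡ b}
      (λ {xy} (s , eq) → Δ₂ xy , Δ₂∣resultant (proj₁ (S⊆ s)) , s , eq , refl) D-divisors λ b →
    atMost-1 λ (s , s₁ , s₂) (t , t₁ , t₂) → determined s t (trans s₁ (sym t₁)) (trans s₂ (sym t₂))
    where
    D-divisors : AtMost L (λ i → ℤ.∣ i ∣ ∣ ℤ.∣ resultant h ∣)
    D-divisors = divisors ℤ.∣ resultant h ∣ {{≢-nonZero (D≢0 ∘ ℤ.∣i∣≡0⇒i≡0)}} D≤

  atMost-DisjointSol₂-h₀≢0 : ∀ {h} → h 0F ≢ 0ℤ → AtMost (L * (L * 1)) (DisjointSol {2} P h)
  atMost-DisjointSol₂-h₀≢0 h₀≢0 = atMost-Δ (λ s → s) λ (s , _) (t , _) → Δ-determine h₀≢0 s t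

  -- Since `h 0F` may be zero here, y₁ is chosen as well, at the cost of a factor `P`.
  atMost-DisjointSol₂ : ∀ {h} → AtMost (P * (L * (L * 1))) (DisjointSol {2} P h)
  atMost-DisjointSol₂ {h} =
    atMost-fibres {R = λ z xy → DisjointSol P h xy × lookup (proj₂ xy) 0F ≡ z}
      (λ {xy} s → lookup (proj₂ xy) 0F , y-range (proj₁ s) 0F , s , refl) atMost-Range λ z →
    atMost-Δ proj₁ λ ((s , _) , y≡z) ((t , _) , y′≡z) eq₁ eq₂ →
      Δ-y₁-determine s t eq₁ eq₂ (trans y≡z (sym y′≡z))

  atMost-Sol₂ : ∀ {h} → Nonzero h → AtMost (2 * (2 * (P * 1)) + P * (L * (L * 1))) (Sol {2} P h)
  atMost-Sol₂ {h} h≢0 = atMost-⊎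
    (λ {xy} s → Sum.map (s ,_) (s ,_) (overlap⊎disjoint xy))
    (sol-overlap (atMost-Sol₁ h≢0)) atMost-DisjointSol₂

  atMost-DisjointSol₃ : ∀ {h} →
    AtMost (P * (P * (L * (L * 1)) + P * (L * (L * 1)))) (DisjointSol {3} P h)
  atMost-DisjointSol₃ {h} =
    atMost-fibres {R = λ s xy → DisjointSol P h xy × lookup (proj₁ xy) 0F ≡ s}
      (λ {xy} d → lookup (proj₁ xy) 0F , x-range (proj₁ d) 0F , d , refl) atMost-Range λ s →
    atMost-⊎
      {T = λ xy → (DisjointSol P h xy × lookup (proj₁ xy) 0F ≡ s)
                    × shift h s (lookup (proj₂ xy) 0F) 0F ≡ 0ℤ}
      {U = λ xy → (DisjointSol P h xy × lookup (proj₁ xy) 0F ≡ s)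
                    × shift h s (lookup (proj₂ xy) 0F) 0F ≢ 0ℤ}
      (λ {xy} → split xy)
      -- The shifted linear entry vanishes only for y₁ = s - `h 0F`, so the weaker bound for two
      -- pairs is paid once for each `s`.
      (atMost-remove {s = s} {t = s ℤ.- h 0F} 0F 0F
        (λ { {xy} ((d , refl) , eq) →
             let y≡ = determined (h 0F) s (lookup (proj₂ xy) 0F) eq in refl , y≡ , remove′ d y≡ })
        (atMost-DisjointSol₂ {shift h s (s ℤ.- h 0F)}))
      (atMost-fibres
        {R = λ t xy → ((DisjointSol P h xy × lookup (proj₁ xy) 0F ≡ s)
                        × shift h s (lookup (proj₂ xy) 0F) 0F ≢ 0ℤ) × lookup (proj₂ xy) 0F ≡ t}
        (λ {xy} d → lookup (proj₂ xy) 0F , y-range (proj₁ (proj₁ (proj₁ d))) 0F , d , refl)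
        atMost-Range λ t → fixed s t)
    where
    split : ∀ {s} xy → DisjointSol {3} P h xy × lookup (proj₁ xy) 0F ≡ s → _ ⊎ _
    split {s} xy d with shift h s (lookup (proj₂ xy) 0F) 0F ℤ.≟ 0ℤ
    ... | yes eq = inj₁ (d , eq)
    ... | no neq = inj₂ (d , neq)

    remove′ : ∀ {xy t} → DisjointSol {3} P h xy → lookup (proj₂ xy) 0F ≡ t →
              DisjointSol P (shift h (lookup (proj₁ xy) 0F) t) (remove 0F 0F xy)
    remove′ {xy} (s , x≢y) refl = sol-remove 0F 0F s , disjoint-remove {xy = xy} 0F 0F x≢y

    determined : ∀ a s t → a ℤ.- (s ℤ.* 1ℤ ℤ.- t ℤ.* 1ℤ) ≡ 0ℤ → t ≡ s ℤ.- a
    determined a s t eq = trans (identity a s t)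
      (trans (cong (λ z → s ℤ.- a ℤ.+ z) eq) (ℤ.+-identityʳ _))
      where
      identity : ∀ a s t → t ≡ s ℤ.- a ℤ.+ (a ℤ.- (s ℤ.* 1ℤ ℤ.- t ℤ.* 1ℤ))
      identity = ℤSolver.solve-∀

    fixed : ∀ s t → AtMost (L * (L * 1))
      (λ xy → ((DisjointSol {3} P h xy × lookup (proj₁ xy) 0F ≡ s)
                × shift h s (lookup (proj₂ xy) 0F) 0F ≢ 0ℤ) × lookup (proj₂ xy) 0F ≡ t)
    fixed s t with shift h s t 0F ℤ.≟ 0ℤ
    -- Such a `t` belongs to the first case, so nothing is left to count.
    ... | yes eq = atMost-∅ λ { ((_ , neq) , refl) → neq eq }
    ... | no neq = atMost-remove {s = s} {t = t} 0F 0F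
      (λ { (((d , refl) , _) , refl) → refl , refl , remove′ d refl })
      (atMost-DisjointSol₂-h₀≢0 {shift h s t} neq)

  atMost-Sol₃ : ∀ {h} → Nonzero h →
    AtMost (3 * (3 * (P * (2 * (2 * (P * 1)) + P * (L * (L * 1)))))
             + P * (P * (L * (L * 1)) + P * (L * (L * 1)))) (Sol {3} P h)
  atMost-Sol₃ {h} h≢0 = atMost-⊎
    (λ {xy} s → Sum.map (s ,_) (s ,_) (overlap⊎disjoint xy))
    (sol-overlap (atMost-Sol₂ h≢0)) atMost-DisjointSol₃

-- From the list of solutions to codes.

box-unique : ∀ P n → Unique (box P n)
box-unique P zero    = [] ∷ []
box-unique P (suc n) = cartesianProductWith⁺ _∷_ ∷-injective
  (map⁺ (suc-injective ∘ ℤ.+-injective) (upTo⁺ P)) (box-unique P n)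

∈-box⇒Range : ∀ {P n v} → v ∈ box P n → ∀ i → Range P (lookup v i)
∈-box⇒Range {P} {suc n} v∈ i
  with ∈-cartesianProductWith⁻ _∷_ (List.map (λ i → + suc i) (List.upTo P)) (box P n) v∈
∈-box⇒Range {P} {suc n} v∈ (Fin.suc i) | x , xs , x∈ , xs∈ , refl = ∈-box⇒Range xs∈ i
∈-box⇒Range {P} {suc n} v∈ 0F          | x , xs , x∈ , xs∈ , refl
  with ∈-map⁻ (λ i → + suc i) x∈
... | j , j∈ , refl =
  Fin.fromℕ< (∈-upTo⁻ j∈) , cong (λ m → + suc m) (sym (Fin.toℕ-fromℕ< (∈-upTo⁻ j∈)))

lookup-nonzero : ∀ (h : Vec ℤ 3) → h ≢ replicate 3 0ℤ → Nonzero (lookup h)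
lookup-nonzero (_ ∷ _ ∷ _ ∷ []) h≢0 h≡0 =
  h≢0 (cong₂ _∷_ (h≡0 0F) (cong₂ _∷_ (h≡0 1F) (cong (_∷ []) (h≡0 2F))))

S₃≤ : ∀ {P h n} → AtMost n (Sol P (lookup h)) → S₃ P h ≤ n
S₃≤ {P} {h} c = length≤
  (filter⁺ (solution? h) (cartesianProduct⁺ (box-unique P 3) (box-unique P 3)))
  (atMost-⊆ ∈⇒Sol c)
  where
  ∈⇒Sol : ∀ {xy} → xy ∈ _ → Sol P (lookup h) xy
  ∈⇒Sol xy∈ =
    let xy∈box , eqs = ∈-filter⁻ (solution? h) xy∈
        x∈ , y∈ = ∈-cartesianProduct⁻ (box P 3) (box P 3) xy∈box
    in sol (∈-box⇒Range x∈) (∈-box⇒Range y∈) eqs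

-- The bound with exponent 2 + 1/k.

-- The count is at most 47 P^2 L^2 with L = 2 l. The resultant has size O(P^4), so the divisor bound
-- with exponent 8 k gives l^(2k) = O(P) after a fourth root, and the k-th power of L^2 costs a
-- single factor `P`.
S₃^k≤ : ∀ {P l C₀} .{{_ : NonZero P}} k .{{_ : NonZero k}} →
  (∀ n .{{_ : NonZero n}} → n ≤ 12 * (P * (P * (P * P))) → AtMost l (_∣ n)) →
  l ^ (2 * k * 4) ≤ C₀ * (12 * (P * (P * (P * P)))) →
  ∀ h → h ≢ replicate 3 0ℤ →
  S₃ P h ^ k ≤ 47 ^ k * 2 ^ (2 * k) * (12 * C₀) * P ^ suc (2 * k)
S₃^k≤ {P} {l} {C₀} k divisors l^8k≤ h h≢0 = begin
  S₃ P h ^ k                                        ≤⟨ ^-monoˡ-≤ k S₃≤47P²L² ⟩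
  (47 * (P ^ 2 * L ^ 2)) ^ k                        ≡⟨ ^-distribʳ-* 47 (P ^ 2 * L ^ 2) k ⟩
  47 ^ k * (P ^ 2 * L ^ 2) ^ k                      ≡⟨ cong (47 ^ k *_) (^-distribʳ-* (P ^ 2) (L ^ 2) k) ⟩
  47 ^ k * ((P ^ 2) ^ k * (L ^ 2) ^ k)
    ≡⟨ cong (47 ^ k *_) (cong₂ _*_ (^-*-assoc P 2 k) (^-*-assoc L 2 k)) ⟩
  47 ^ k * (P ^ (2 * k) * L ^ (2 * k))
    ≡⟨ cong (λ z → 47 ^ k * (P ^ (2 * k) * z)) (^-distribʳ-* l 2 (2 * k)) ⟩
  47 ^ k * (P ^ (2 * k) * (l ^ (2 * k) * 2 ^ (2 * k)))
    ≤⟨ *-monoʳ-≤ (47 ^ k) (*-monoʳ-≤ (P ^ (2 * k)) (*-monoˡ-≤ (2 ^ (2 * k)) l^2k≤)) ⟩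
  47 ^ k * (P ^ (2 * k) * (12 * C₀ * P * 2 ^ (2 * k)))
    ≡⟨ rearrange (47 ^ k) (P ^ (2 * k)) (12 * C₀) P (2 ^ (2 * k)) ⟩
  47 ^ k * 2 ^ (2 * k) * (12 * C₀) * P ^ suc (2 * k)  ∎
  where
  open ≤-Reasoning
  L = l * 2

  rearrange : ∀ a b c d e → a * (b * (c * d * e)) ≡ a * e * c * (d * b)
  rearrange = ℕSolver.solve-∀

  1≤12P⁴ : 1 ≤ 12 * (P * (P * (P * P)))
  1≤12P⁴ = *-mono-≤ {1} {12} (s≤s z≤n) (*-mono-≤ 1≤P (*-mono-≤ 1≤P (*-mono-≤ 1≤P 1≤P)))
    where
    1≤P = >-nonZero⁻¹ P

  -- The divisor 1 of 1 has a code in `Fin l`, so `l` is positive. This allows P^2 to be absorbed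
  -- into P^2 L^2.
  L≥1 : 1 ≤ L
  L≥1 = ≤-trans (>-nonZero⁻¹ l {{Fin.nonZeroIndex (code (divisors 1 1≤12P⁴) (1∣ 1))}}) (m≤m*n l 2)

  -- The constant is raised to the fourth power as well, so that the whole right-hand side has an
  -- exact fourth root.
  l^2k≤ : l ^ (2 * k) ≤ 12 * C₀ * P
  l^2k≤ = ^-cancelˡ-≤ 4 (begin
    (l ^ (2 * k)) ^ 4                ≡⟨ ^-*-assoc l (2 * k) 4 ⟩
    l ^ (2 * k * 4)                  ≤⟨ l^8k≤ ⟩
    C₀ * (12 * (P * (P * (P * P))))  ≡⟨ regroup C₀ P ⟩
    12 * C₀ * P ^ 4                  ≤⟨ *-monoˡ-≤ (P ^ 4) (m≤m^n (12 * C₀) 4) ⟩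
    (12 * C₀) ^ 4 * P ^ 4            ≡⟨ ^-distribʳ-* (12 * C₀) P 4 ⟨
    (12 * C₀ * P) ^ 4                ∎)
    where
    regroup : ∀ c p → c * (12 * (p * (p * (p * p)))) ≡ 12 * c * (p * (p * (p * (p * 1))))
    regroup = ℕSolver.solve-∀

  S₃≤47P²L² : S₃ P h ≤ 47 * (P ^ 2 * L ^ 2)
  S₃≤47P²L² = begin
    S₃ P h
      ≤⟨ S₃≤ {h = h} (atMost-Sol₃ (lookup-nonzero h h≢0)) ⟩
    3 * (3 * (P * (2 * (2 * (P * 1)) + P * (L * (L * 1)))))
      + P * (P * (L * (L * 1)) + P * (L * (L * 1)))
      -- Two coincidences in succession give 3 * 3 * 2 * 2 = 36; the terms with L^2 give 9 from one
      -- coincidence and 2 from none.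
      ≡⟨ collect P L ⟩
    36 * (P * (P * 1)) + 11 * (P ^ 2 * L ^ 2)
      ≤⟨ +-monoˡ-≤ (11 * (P ^ 2 * L ^ 2)) (*-monoʳ-≤ 36 (m≤m*n (P ^ 2) (L ^ 2))) ⟩
    36 * (P ^ 2 * L ^ 2) + 11 * (P ^ 2 * L ^ 2)
      ≡⟨ *-distribʳ-+ (P ^ 2 * L ^ 2) 36 11 ⟨
    47 * (P ^ 2 * L ^ 2) ∎
    where
    open Count {P} {L} (λ n n≤ → atMost-ℤdivisors (divisors n n≤))
    instance
      L²≢0 : NonZero (L ^ 2)
      L²≢0 = m^n≢0 L 2 {{>-nonZero L≥1}}
    collect : ∀ p l → 3 * (3 * (p * (2 * (2 * (p * 1)) + p * (l * (l * 1)))))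
                        + p * (p * (l * (l * 1)) + p * (l * (l * 1)))
                      ≡ 36 * (p * (p * 1)) + 11 * (p * (p * 1) * (l * (l * 1)))
    collect = ℕSolver.solve-∀

S₃^k≤C*P^[2k+1] : ∀ k .{{_ : NonZero k}} → ∃[ C ] (∀ (h : Vec ℤ 3) → h ≢ replicate 3 0ℤ →
  ∀ P .{{_ : NonZero P}} → S₃ P h ^ k ≤ C * P ^ suc (2 * k))
S₃^k≤C*P^[2k+1] k =
  let C₀ , bound = uniformDivisorBound (2 * k * 4) {{m*n≢0 (2 * k) 4 {{m*n≢0 2 k}}}}
  in 47 ^ k * 2 ^ (2 * k) * (12 * C₀) , λ h h≢0 P →
     let l , divisors , l^8k≤ = bound (12 * (P * (P * (P * P))))
     in S₃^k≤ {C₀ = C₀} k divisors l^8k≤ h h≢0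

-- Passage to real exponents.

lower<upper : ∀ (x : ℝ) {p q} → lower x p → upper x q → p ℚ.< q
lower<upper x {p} {q} l u with ℚ.<-cmp p q
... | tri< p<q _ _    = p<q
... | tri≈ _ refl _   = contradiction (l , u) (disjoint x)
... | tri> _ _ q<p    = contradiction (l , upper-closed x q<p u) (disjoint x)

-- The denominator k of a positive rational below ε satisfies 1 / k ≤ ε.
exponent-bound : ∀ (ε : ℝ) → Positive ε → ∃[ k ] NonZero k ×
  (∀ r → upper ((+ 2 / 1) ⊕ ε) r → ∃[ a ] ↥ r ≡ + a × suc (2 * k) * ↧ₙ r ≤ a * k)
exponent-bound ε ε>0 with lower-open ε ε>0
... | q@(mkℚ +[1+ m ] d-1 _) , _ , l = suc d-1 , _ , bound
  where
  k = suc d-1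

  q+2<r : ∀ {r} → upper ((+ 2 / 1) ⊕ ε) r → q ℚ.+ + 2 / 1 ℚ.< r
  q+2<r {r} u = subst (q ℚ.+ + 2 / 1 ℚ.<_)
    (trans (ℚ.+-assoc r (ℚ.- (+ 2 / 1)) (+ 2 / 1)) (ℚ.+-identityʳ r))
    (ℚ.+-monoˡ-< (+ 2 / 1) (lower<upper ε l u))

  -- The unnormalised sum has an explicit numerator and denominator to cross-multiply, while the
  -- normalised one is reduced by a gcd.
  q+2<ᵘr : ∀ {r} → upper ((+ 2 / 1) ⊕ ε) r → ℚ.toℚᵘ q ℚᵘ.+ ℚᵘ.mkℚᵘ (+ 2) 0 ℚᵘ.< ℚ.toℚᵘ r
  q+2<ᵘr u = ℚᵘ.<-respˡ-≃ (ℚ.toℚᵘ-homo-+ q (+ 2 / 1)) (ℚ.toℚᵘ-mono-< (q+2<r u))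

  clear-denominators : ∀ s → ℚ.toℚᵘ q ℚᵘ.+ ℚᵘ.mkℚᵘ (+ 2) 0 ℚᵘ.< s →
                       ∃[ a ] ℚᵘ.↥ s ≡ + a × suc (2 * k) * ℚᵘ.↧ₙ s ≤ a * k
  clear-denominators (ℚᵘ.mkℚᵘ -[1+ _ ] _) (ℚᵘ.*<* ())
  clear-denominators (ℚᵘ.mkℚᵘ (+ a) d)    (ℚᵘ.*<* lt) = a , refl , (begin
    -- The numerator of `q` is at least 1, so (2 k + 1) / k is at most q + 2.
    suc (2 * k) * suc d              ≤⟨ *-monoˡ-≤ (suc d) (+-monoˡ-≤ (2 * k) (s≤s (z≤n {m * 1}))) ⟩
    (suc m * 1 + 2 * k) * suc d      ≤⟨ <⇒≤ (ℤ.drop‿+<+ (subst (+ ((suc m * 1 + 2 * k) * suc d) ℤ.<_)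
                                          (sym (ℤ.pos-* a (k * 1))) lt)) ⟩
    a * (k * 1)                      ≡⟨ cong (a *_) (*-identityʳ k) ⟩
    a * k                            ∎)
    where open ≤-Reasoning

  bound : ∀ r → upper ((+ 2 / 1) ⊕ ε) r → ∃[ a ] ↥ r ≡ + a × suc (2 * k) * ↧ₙ r ≤ a * k
  bound r@record{} u = clear-denominators (ℚ.toℚᵘ r) (q+2<ᵘr {r} u)
... | mkℚ (+ 0) _ _ , ℚ.*<* (ℤ.+<+ ()) , _
... | mkℚ -[1+ _ ] _ _ , ℚ.*<* () , _

-- Compare k-th powers: S^(dk) is at most C^d P^((2k+1)d), hence at most C^(dk) P^(ak), and a k-th
-- root gives the claim.
^-bound-root : ∀ {S C P k a} d .{{_ : NonZero k}} .{{_ : NonZero P}} →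
               S ^ k ≤ C * P ^ suc (2 * k) → suc (2 * k) * d ≤ a * k → S ^ d ≤ C ^ d * P ^ a
^-bound-root {S} {C} {P} {k} {a} d S^k≤ le = ^-cancelˡ-≤ k (begin
  (S ^ d) ^ k                        ≡⟨ ^-*-assoc S d k ⟩
  S ^ (d * k)                        ≡⟨ cong (S ^_) (*-comm d k) ⟩
  S ^ (k * d)                        ≡⟨ ^-*-assoc S k d ⟨
  (S ^ k) ^ d                        ≤⟨ ^-monoˡ-≤ d S^k≤ ⟩
  (C * P ^ suc (2 * k)) ^ d          ≡⟨ ^-distribʳ-* C (P ^ suc (2 * k)) d ⟩
  C ^ d * (P ^ suc (2 * k)) ^ d      ≡⟨ cong (C ^ d *_) (^-*-assoc P (suc (2 * k)) d) ⟩
  C ^ d * P ^ (suc (2 * k) * d)      ≤⟨ *-mono-≤ (m≤m^n (C ^ d) k) (^-monoʳ-≤ P le) ⟩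
  (C ^ d) ^ k * P ^ (a * k)          ≡⟨ cong ((C ^ d) ^ k *_) (^-*-assoc P a k) ⟨
  (C ^ d) ^ k * (P ^ a) ^ k          ≡⟨ ^-distribʳ-* (C ^ d) (P ^ a) k ⟨
  (C ^ d * P ^ a) ^ k                ∎)
  where open ≤-Reasoning

-- `PowerBoundℚ` branches on the sign of the numerator; the exponents in question exceed 2, so only
-- the nonnegative branch occurs.
PowerBoundℚ-intro : ∀ {n C P a} r → ↥ r ≡ + a →
                    n ^ ↧ₙ r ≤ C ^ ↧ₙ r * P ^ a → PowerBoundℚ n C P r
PowerBoundℚ-intro r ↥r≡a le with ↥ r | ↥r≡a
... | _ | refl = le

PowerBound-root : ∀ {S C P k} x .{{_ : NonZero k}} .{{_ : NonZero P}} →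
  (∀ r → upper x r → ∃[ a ] ↥ r ≡ + a × suc (2 * k) * ↧ₙ r ≤ a * k) →
  S ^ k ≤ C * P ^ suc (2 * k) → PowerBound S C P x
PowerBound-root {C = C} {k = k} x exponents S^k≤ r u =
  let a , ↥r≡a , le = exponents r u
  in PowerBoundℚ-intro r ↥r≡a (^-bound-root {C = C} {k = k} {a = a} (↧ₙ r) S^k≤ le)

corollary1p2 : ∀ (ε : ℝ) → Positive ε →
    ∃[ C ] (∀ (h : Vec ℤ 3) → h ≢ replicate 3 0ℤ →
    ∀ (P : ℕ) → .{{_ : NonZero P}} → PowerBound (S₃ P h) C P ((+ 2 / 1) ⊕ ε))
corollary1p2 ε ε>0 =
  let k , k≢0 , exponents = exponent-bound ε ε>0
      C , bound = S₃^k≤C*P^[2k+1] k {{k≢0}}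
  in C , λ h h≢0 P → PowerBound-root {S₃ P h} {C} ((+ 2 / 1) ⊕ ε) {{k≢0}} exponents (bound h h≢0 P)
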